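{- In the extended lazy lambda calculus $L_{lcc}$, the open extension of similarity coincides with contextual preorder: $\preccurlyeq_{lcc}^{o}\;=\;\le_{lcc}$ as binary relations on $\mathbb{E}_\lambda$.
   Context: **The calculus $L_{lcc}$.** Fix a set of data constructors partitioned into types; each constructor $c$ has an arity $\mathrm{ar}(c)\ge 0$; the constructors of type $T$ are enumerated as $c_{T,1},\dots,c_{T,|T|}$; there is a type Bool with nullary constructors True, False. Constructors occur only fully saturated. Expressions $\mathbb{E}_\lambda$ (up to $\alpha$-equivalence): $s,t::=x\mid(s\ t)\mid(\lambda x.s)\mid(c\ s_1\dots s_{\mathrm{ar}(c)})\mid(\mathtt{case}_T\ s\ \mathtt{of}\ alts)\mid(\mathtt{seq}\ s\ t)$, where $alts$ has exactly one alternative $((c\ y_1\dots y_{\mathrm{ar}(c)})\to r)$ for each constructor $c$ of type $T$ (the $y_i$ distinct variables bound in $r$). Contexts $\mathbb{C}_\lambda$: expressions with one hole $[\cdot]$ replacing a subexpression. Answers (values): abstractions and constructor applications. Reduction contexts $R::=[\cdot]\mid(R\ s)\mid\mathtt{case}_T\ R\ \mathtt{of}\ alts\mid\mathtt{seq}\ R\ s$. Reduction $\xrightarrow{lcc}$: $R[((\lambda x.s)\ t)]\to R[s[t/x]]$; $R[\mathtt{case}_T\ (c\ s_1\dots s_k)\ \mathtt{of}\dots((c\ x_1\dots x_k)\to t)\dots]\to R[t[s_1/x_1,\dots,s_k/x_k]]$; $R[\mathtt{seq}\ v\ s]\to R[s]$ for a value $v$. $s\downarrow_{lcc}v$ means $s\xrightarrow{lcc,*}v$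 for the answer $v$; $s\downarrow_{lcc}$ means such $v$ exists; otherwise $s$ diverges. Contextual preorder: $s\le_{lcc}t$ iff for all $C\in\mathbb{C}_\lambda$: $C[s]\downarrow_{lcc}\Rightarrow C[t]\downarrow_{lcc}$. **Similarity.** $cBot$ is the set of $s\in\mathbb{E}_\lambda$ such that for all substitutions $\sigma$: if $\sigma(s)$ is closed, then $\sigma(s)$ diverges. For a relation $\eta$ on closed expressions, the open extension $\eta^o$ is: $s\,\eta^o\,t$ iff $\sigma(s)\,\eta\,\sigma(t)$ for all substitutions $\sigma$ with $\sigma(s),\sigma(t)$ closed. $\preccurlyeq_{lcc}$ is the greatest fixpoint of the monotone operator $F_{lcc}$ on binary relations on closed $\mathbb{E}_\lambda$-expressions: $s\,F_{lcc}(\eta)\,t$ iff (1) if $s\downarrow_{lcc}\lambda x.s'$, then either $t\downarrow_{lcc}\lambda x.t'$ with $s'\,\eta^o\,t'$, or $t\downarrow_{lcc}(c\ t_1'\dots t_n')$ for some constructor $c$ and $s'\in cBot$; and (2) if $s\downarrow_{lcc}(c\ s_1'\dots s_n')$, then $t\downarrow_{lcc}(c\ t_1'\dots t_n')$ with $s_i'\,\eta\,t_i'$ for all $i$. -}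

module Defs where

open import Data.Nat.Base using (ℕ; suc; _+_)
open import Data.Fin.Base using (Fin)
open import Data.Fin.Substitution using (Sub; Lift; TermSubst)
open import Data.List.Base using (List; []; _∷_; length; lookup)
open import Data.List.Membership.Propositional.Properties using (∈-lookup)
open import Data.List.Relation.Unary.All as All using (All; []; _∷_)
open import Data.Vec.Base as Vec using (Vec; []; _∷_; _++_; tabulate)
open import Data.Empty using (⊥)
open import Data.Product.Base using (_×_; _,_; proj₁; proj₂; ∃; ∃-syntax)
open import Data.Sum.Base as Sum using (_⊎_; inj₁; inj₂)
open import Function.Bundles using (_↣_; module Injection)
open import Level using (Level; 0ℓ) renaming (suc to lsuc)
open import Relation.Binary.Core using (Rel)
open import Relation.Binary.Construct.Closure.ReflexiveTransitive using (Star)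
open import Relation.Binary.PropositionalEquality.Core using (_≡_; _≢_; refl)
open import Relation.Nullary.Negation.Core using (¬_)

-- The constructors of a type are given by the list of their arities: c_{T,i}
-- is the i-th position of that list.
record Signature : Set₁ where
  field
    Type     : Set
    arities  : Type → List ℕ
    nonempty : ∀ T → arities T ≢ []
    -- Bool has exactly the two nullary constructors True and False.
    Bool     : Type
    bool     : arities Bool ≡ 0 ∷ 0 ∷ []

  ∣_∣ : Type → ℕ
  ∣ T ∣ = length (arities T)

  ar : (T : Type) → Fin ∣ T ∣ → ℕ
  ar T = lookup (arities T)

module Lcc (Sig : Signature) where
  open Signature Sig public

  private variable
    k m n : ℕ
    ℓ : Level

  infixl 9 _·_

  -- Expressions up to α-equivalence: Expr n are the expressions whose free
  -- variables are among n given ones (de Bruijn indices).  In an alternative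
  -- (c y₁ … yₐ) → r, the pattern variable yᵢ is the index i - 1 of r.
  data Expr (n : ℕ) : Set where
    var  : Fin n → Expr n
    _·_  : Expr n → Expr n → Expr n
    ƛ    : Expr (1 + n) → Expr n
    con  : (T : Type) (c : Fin ∣ T ∣) → Vec (Expr n) (ar T c) → Expr n
    case : (T : Type) → Expr n → All (λ a → Expr (a + n)) (arities T) → Expr n
    seq  : Expr n → Expr n → Expr n

  Alts : List ℕ → ℕ → Set
  Alts as n = All (λ a → Expr (a + n)) as

  alternative : {T : Type} → Alts (arities T) n → (c : Fin ∣ T ∣) → Expr (ar T c + n)
  alternative alts c = All.lookup alts (∈-lookup c)

  module ExprApp {S : ℕ → Set} (l : Lift S Expr) where
    open Lift l using (lift; _↑⋆_)

    infixl 8 _/_ _/ᵛ_ _/ᵃ_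

    _/_  : Expr m → Sub S m n → Expr n
    _/ᵛ_ : Vec (Expr m) k → Sub S m n → Vec (Expr n) k
    _/ᵃ_ : ∀ {as} → Alts as m → Sub S m n → Alts as n

    var x         / σ = lift (Vec.lookup σ x)
    (s · t)       / σ = (s / σ) · (t / σ)
    ƛ s           / σ = ƛ (s / σ ↑⋆ 1)
    con T c ss    / σ = con T c (ss /ᵛ σ)
    case T s alts / σ = case T (s / σ) (alts /ᵃ σ)
    seq s t       / σ = seq (s / σ) (t / σ)

    []       /ᵛ σ = []
    (s ∷ ss) /ᵛ σ = (s / σ) ∷ (ss /ᵛ σ)

    []                   /ᵃ σ = []
    (_∷_ {x = a} r alts) /ᵃ σ = (r / σ ↑⋆ a) ∷ (alts /ᵃ σ)

  exprSubst : TermSubst Expr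
  exprSubst = record { var = var ; app = ExprApp._/_ }

  open TermSubst exprSubst public using (_/_; _/Var_; id; sub)

  -- Ctx n m: contexts with free variables among m whose hole takes elements of
  -- Expr n.  A hole may capture any of the free variables of the expression
  -- put into it, so it records to which of the variables in scope at the hole
  -- each of the n variables refers; different names remain different
  -- variables, hence injectivity.
  mutual
    data Ctx (n : ℕ) : ℕ → Set where
      hole   : Fin n ↣ Fin m → Ctx n m
      appˡ   : Ctx n m → Expr m → Ctx n m
      appʳ   : Expr m → Ctx n m → Ctx n m
      ƛ      : Ctx n (1 + m) → Ctx n m
      con    : (T : Type) (c : Fin ∣ T ∣) → VecCtx n m (ar T c) → Ctx n m
      caseˢ  : (T : Type) → Ctx n m → Alts (arities T) m → Ctx n m
      caseᵃ  : (T : Type) → Expr m → AltsCtx n m (arities T) → Ctx n m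
      seqˡ   : Ctx n m → Expr m → Ctx n m
      seqʳ   : Expr m → Ctx n m → Ctx n m

    data VecCtx (n m : ℕ) : ℕ → Set where
      here  : Ctx n m → Vec (Expr m) k → VecCtx n m (suc k)
      there : Expr m → VecCtx n m k → VecCtx n m (suc k)

    data AltsCtx (n m : ℕ) : List ℕ → Set where
      here  : ∀ {a as} → Ctx n (a + m) → Alts as m → AltsCtx n m (a ∷ as)
      there : ∀ {a as} → Expr (a + m) → AltsCtx n m as → AltsCtx n m (a ∷ as)

  infix 10 _[_] _[_]ᵛ _[_]ᵃ _[_]ᴿ

  _[_]  : Ctx n m → Expr n → Expr m
  _[_]ᵛ : VecCtx n m k → Expr n → Vec (Expr m) k
  _[_]ᵃ : ∀ {as} → AltsCtx n m as → Expr n → Alts as m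

  hole ρ       [ s ] = s /Var tabulate (Injection.to ρ)
  appˡ C t     [ s ] = C [ s ] · t
  appʳ t C     [ s ] = t · C [ s ]
  ƛ C          [ s ] = ƛ (C [ s ])
  con T c Cs   [ s ] = con T c (Cs [ s ]ᵛ)
  caseˢ T C as [ s ] = case T (C [ s ]) as
  caseᵃ T t Cs [ s ] = case T t (Cs [ s ]ᵃ)
  seqˡ C t     [ s ] = seq (C [ s ]) t
  seqʳ t C     [ s ] = seq t (C [ s ])

  here C ts  [ s ]ᵛ = C [ s ] ∷ ts
  there t Cs [ s ]ᵛ = t ∷ Cs [ s ]ᵛ

  here C as  [ s ]ᵃ = C [ s ] ∷ as
  there r Cs [ s ]ᵃ = r ∷ Cs [ s ]ᵃ

  data Answer {n : ℕ} : Expr n → Set where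
    ƛ   : (s : Expr (1 + n)) → Answer (ƛ s)
    con : (T : Type) (c : Fin ∣ T ∣) (ss : Vec (Expr n) (ar T c)) → Answer (con T c ss)

  data RCtx (n : ℕ) : Set where
    □    : RCtx n
    app  : RCtx n → Expr n → RCtx n
    case : (T : Type) → RCtx n → Alts (arities T) n → RCtx n
    seq  : RCtx n → Expr n → RCtx n

  _[_]ᴿ : RCtx n → Expr n → Expr n
  □             [ s ]ᴿ = s
  app R t       [ s ]ᴿ = R [ s ]ᴿ · t
  case T R alts [ s ]ᴿ = case T (R [ s ]ᴿ) alts
  seq R t       [ s ]ᴿ = seq (R [ s ]ᴿ) t

  infix 5 _⇓
  infix 4 _⟶₀_ _⟶_ _⟶*_ _↓_ _≤lcc_ _≼_

  data _⟶₀_ {n : ℕ} : Expr n → Expr n → Set where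
    β     : ∀ {s t} → ƛ s · t ⟶₀ s / sub t
    caseβ : ∀ {T c ss alts} →
            case T (con T c ss) alts ⟶₀ alternative alts c / (ss ++ id)
    seqβ  : ∀ {v s} → Answer v → seq v s ⟶₀ s

  data _⟶_ {n : ℕ} : Expr n → Expr n → Set where
    inR : ∀ (R : RCtx n) {s t} → s ⟶₀ t → R [ s ]ᴿ ⟶ R [ t ]ᴿ

  _⟶*_ : Rel (Expr n) 0ℓ
  _⟶*_ = Star _⟶_

  _↓_ : Rel (Expr n) 0ℓ
  s ↓ v = s ⟶* v × Answer v

  _⇓ : Expr n → Set
  s ⇓ = ∃[ v ] s ↓ v

  Diverges : Expr n → Set
  Diverges s = ¬ s ⇓

  _≤lcc_ : Rel (Expr n) 0ℓ
  _≤lcc_ {n} s t = ∀ {m} (C : Ctx n m) → C [ s ] ⇓ → C [ t ] ⇓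

  Closed : Set
  Closed = Expr 0

  cBot : Expr n → Set
  cBot {n} s = (σ : Sub Expr n 0) → Diverges (s / σ)

  infix 8 _ᵒ

  _ᵒ : Rel Closed ℓ → ∀ {n} → Rel (Expr n) ℓ
  (η ᵒ) {n} s t = (σ : Sub Expr n 0) → η (s / σ) (t / σ)

  F : Rel Closed ℓ → Rel Closed ℓ
  F η s t =
    (∀ {s′} → s ↓ ƛ s′ →
       (∃[ t′ ] t ↓ ƛ t′ × (η ᵒ) s′ t′)
       ⊎ ((∃[ T ] ∃[ c ] ∃[ ts ] t ↓ con T c ts) × cBot s′))
    ×
    (∀ {T c ss} → s ↓ con T c ss →
       ∃[ ts ] t ↓ con T c ts × (∀ i → η (Vec.lookup ss i) (Vec.lookup ts i)))

  -- Similarity, the greatest fixpoint of F, as the union of all its post-fixed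
  -- points.  This union lives one universe up; that it is nevertheless a
  -- fixpoint of F is shown by ≼⇒F and F⇒≼.
  _≼_ : Rel Closed (lsuc 0ℓ)
  s ≼ t = ∃[ η ] (∀ u v → η u v → F {0ℓ} η u v) × η s t

  ≼-greatest : (η : Rel Closed 0ℓ) → (∀ u v → η u v → F η u v) → ∀ s t → η s t → s ≼ t
  ≼-greatest η post s t p = η , post , p

  F-mono : ∀ {a b} {η : Rel Closed a} {θ : Rel Closed b} →
           (∀ u v → η u v → θ u v) → ∀ s t → F η s t → F θ s t
  F-mono i s t (f , g) =
    (λ e → Sum.map₁ (λ (t′ , d , h) → t′ , d , λ σ → i _ _ (h σ)) (f e)) ,
    (λ e → let (ts , d , h) = g e in ts , d , λ j → i _ _ (h j))

  ≼⇒F : ∀ s t → s ≼ t → F _≼_ s t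
  ≼⇒F s t (η , post , p) = F-mono (≼-greatest η post) s t (post s t p)

  F⇒≼ : ∀ s t → F _≼_ s t → s ≼ t
  F⇒≼ s t (f , g) = θ , θ-post , root
    where
    Clauseƛ : ∀ {a} → Rel Closed a → Expr 1 → Set a
    Clauseƛ η s′ = (∃[ t′ ] t ↓ ƛ t′ × (η ᵒ) s′ t′)
                   ⊎ ((∃[ T ] ∃[ c ] ∃[ ts ] t ↓ con T c ts) × cBot s′)

    viaƛ : ∀ s′ → Clauseƛ _≼_ s′ → Rel Closed 0ℓ
    viaƛ s′ (inj₁ (_ , _ , h)) u v = ∃[ σ ] proj₁ (h σ) u v
    viaƛ s′ (inj₂ _)           u v = ⊥

    -- The pair (s, t) together with all post-fixed points that F _≼_ s t uses.
    data θ : Rel Closed 0ℓ where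
      root : θ s t
      inƛ  : ∀ {s′ u v} (e : s ↓ ƛ s′) → viaƛ s′ (f e) u v → θ u v
      inC  : ∀ {T c ss u v} (e : s ↓ con T c ss) i →
             proj₁ (proj₂ (proj₂ (g e)) i) u v → θ u v

    viaƛ-post : ∀ s′ (x : Clauseƛ _≼_ s′) → (∀ u v → viaƛ s′ x u v → θ u v) →
                ∀ u v → viaƛ s′ x u v → F θ u v
    viaƛ-post s′ (inj₁ (_ , _ , h)) i u v (σ , p) =
      F-mono (λ u v q → i u v (σ , q)) u v (proj₁ (proj₂ (h σ)) u v p)

    θ-ƛ : ∀ s′ (x : Clauseƛ _≼_ s′) → (∀ u v → viaƛ s′ x u v → θ u v) → Clauseƛ θ s′
    θ-ƛ s′ (inj₁ (t′ , d , h)) i = inj₁ (t′ , d , λ σ → i _ _ (σ , proj₂ (proj₂ (h σ))))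
    θ-ƛ s′ (inj₂ y)            i = inj₂ y

    θ-post : ∀ u v → θ u v → F θ u v
    θ-post u v root =
      (λ {s′} e → θ-ƛ s′ (f e) (λ _ _ → inƛ e)) ,
      (λ e → let (ts , d , h) = g e in ts , d , λ i → inC e i (proj₂ (proj₂ (h i))))
    θ-post u v (inƛ {s′} e p) = viaƛ-post s′ (f e) (λ _ _ → inƛ e) u v p
    θ-post u v (inC e i p)    =
      F-mono (λ u v → inC {u = u} {v} e i) u v (proj₁ (proj₂ (proj₂ (proj₂ (g e)) i)) u v p)

{-# OPTIONS --safe #-}

-- Howe's method.  The compatible and substitutive relation ≾ generated by
-- similarity preserves convergence, by induction on the evaluation of the left
-- hand side; as similar expressions in a context are related by ≾, similarity
-- implies contextual preorder.  When an abstraction is simulated by a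
-- constructor application, the body s′ ∈ cBot is replaced in this induction by
-- s′ ≾ Ω: applying the abstraction then gives an expression related to Ω, so by
-- the induction hypothesis it has no evaluation.
--
-- Conversely, contextual preorder on closed expressions is a post-fixed point of
-- F: application and case contexts observe bodies and components, and evaluation
-- is contained in contextual equivalence by the first part.  Open expressions
-- are closed by the contexts (λ x . [·]) r.

module Submission where

open import Defs
open import Data.Nat.Base using (ℕ; zero; suc; _+_)
open import Data.Fin.Base using (Fin; zero; suc; _↑ˡ_)
open import Data.Fin.Properties using (_≟_; lift-injective)
open import Data.Fin.Substitution using (Sub; Subs; Lift; TermSubst)
open import Data.Fin.Substitution.Lemmas using (TermLemmas)
open import Data.List.Base using (List; []; _∷_; length; lookup)
open import Data.List.Membership.Propositional.Properties using (∈-lookup)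
open import Data.List.Relation.Unary.All as All using (All; []; _∷_)
open import Data.Vec.Base as Vec using (Vec; []; _∷_; _++_; tabulate; map)
import Data.Vec.Properties as Vec
open import Data.Vec.Relation.Binary.Pointwise.Inductive as Pointwise using (Pointwise; []; _∷_)
open import Data.Product.Base using (_×_; _,_; proj₁; proj₂; ∃-syntax)
open import Data.Sum.Base using (_⊎_; inj₁; inj₂)
open import Data.Empty using (⊥-elim)
open import Function.Base using (_∘_)
open import Function.Bundles using (_⇔_; mk⇔; _↣_; mk↣; module Injection)
open import Function.Construct.Identity using (↣-id)
open import Level using (Level; 0ℓ)
open import Relation.Binary.Construct.Closure.ReflexiveTransitive
  using (ε; _◅_; _◅◅_; gmap)
open import Relation.Binary.Core using (Rel)
open import Relation.Binary.PropositionalEquality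
  using (_≡_; _≢_; refl; sym; trans; cong; cong₂; subst; subst₂)
open import Relation.Nullary using (¬_; yes; no)

module Adequacy (Sig : Signature) where
  open Lcc Sig

  private variable
    k m n o : ℕ
    as : List ℕ
    S : ℕ → Set

  -- Substitution lemmas for expressions

  module ExprSubs (l : Lift S Expr) where
    open TermSubst.Lifted exprSubst l public using (_↑⋆_; _↑✶_; _/✶_)
    open ExprApp l public using () renaming (_/_ to _/₁_; _/ᵛ_ to _/ᵛ₁_; _/ᵃ_ to _/ᵃ₁_)

    infixl 8 _/ᵛ✶_ _/ᵃ✶_

    -- The field `/✶-↑✶` of `TermLemmas` speaks of sequences of substitutions, so argument vectors
    -- and alternatives need sequence actions too.
    _/ᵛ✶_ : Vec (Expr m) k → Subs S m n → Vec (Expr n) k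
    ss /ᵛ✶ ε        = ss
    ss /ᵛ✶ (σ ◅ σs) = (ss /ᵛ✶ σs) /ᵛ₁ σ

    _/ᵃ✶_ : Alts as m → Subs S m n → Alts as n
    alts /ᵃ✶ ε        = alts
    alts /ᵃ✶ (σ ◅ σs) = (alts /ᵃ✶ σs) /ᵃ₁ σ

    ·-/✶ : ∀ {s t} (σs : Subs S m n) → (s · t) /✶ σs ≡ (s /✶ σs) · (t /✶ σs)
    ·-/✶ ε        = refl
    ·-/✶ (σ ◅ σs) = cong (_/₁ σ) (·-/✶ σs)

    ƛ-/✶ : ∀ {s} (σs : Subs S m n) → ƛ s /✶ σs ≡ ƛ (s /✶ σs ↑✶ 1)
    ƛ-/✶ ε        = refl
    ƛ-/✶ (σ ◅ σs) = cong (_/₁ σ) (ƛ-/✶ σs)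

    con-/✶ : ∀ {T c ss} (σs : Subs S m n) → con T c ss /✶ σs ≡ con T c (ss /ᵛ✶ σs)
    con-/✶ ε        = refl
    con-/✶ (σ ◅ σs) = cong (_/₁ σ) (con-/✶ σs)

    case-/✶ : ∀ {T s alts} (σs : Subs S m n) →
              case T s alts /✶ σs ≡ case T (s /✶ σs) (alts /ᵃ✶ σs)
    case-/✶ ε        = refl
    case-/✶ (σ ◅ σs) = cong (_/₁ σ) (case-/✶ σs)

    seq-/✶ : ∀ {s t} (σs : Subs S m n) → seq s t /✶ σs ≡ seq (s /✶ σs) (t /✶ σs)
    seq-/✶ ε        = refl
    seq-/✶ (σ ◅ σs) = cong (_/₁ σ) (seq-/✶ σs)

    []-/ᵛ✶ : (σs : Subs S m n) → [] /ᵛ✶ σs ≡ []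
    []-/ᵛ✶ ε        = refl
    []-/ᵛ✶ (σ ◅ σs) = cong (_/ᵛ₁ σ) ([]-/ᵛ✶ σs)

    ∷-/ᵛ✶ : ∀ {s} {ss : Vec (Expr m) k} (σs : Subs S m n) →
            (s ∷ ss) /ᵛ✶ σs ≡ (s /✶ σs) ∷ (ss /ᵛ✶ σs)
    ∷-/ᵛ✶ ε        = refl
    ∷-/ᵛ✶ (σ ◅ σs) = cong (_/ᵛ₁ σ) (∷-/ᵛ✶ σs)

    []-/ᵃ✶ : (σs : Subs S m n) → [] /ᵃ✶ σs ≡ []
    []-/ᵃ✶ ε        = refl
    []-/ᵃ✶ (σ ◅ σs) = cong (_/ᵃ₁ σ) ([]-/ᵃ✶ σs)

    ∷-/ᵃ✶ : ∀ {a r} {alts : Alts as m} (σs : Subs S m n) →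
            _/ᵃ✶_ {as = a ∷ as} (r ∷ alts) σs ≡ (r /✶ σs ↑✶ a) ∷ (alts /ᵃ✶ σs)
    ∷-/ᵃ✶ ε        = refl
    ∷-/ᵃ✶ (σ ◅ σs) = cong (_/ᵃ₁ σ) (∷-/ᵃ✶ σs)

    ↑✶-zero : (σs : Subs S m n) → σs ↑✶ 0 ≡ σs
    ↑✶-zero ε        = refl
    ↑✶-zero (σ ◅ σs) = cong (σ ◅_) (↑✶-zero σs)

    ↑✶-suc : ∀ a (σs : Subs S m n) → (σs ↑✶ a) ↑✶ 1 ≡ σs ↑✶ suc a
    ↑✶-suc a ε        = refl
    ↑✶-suc a (σ ◅ σs) = cong (_ ◅_) (↑✶-suc a σs)

  module SubsEq {S₁ S₂ : ℕ → Set} (l₁ : Lift S₁ Expr) (l₂ : Lift S₂ Expr) where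
    private
      module A = ExprSubs l₁
      module B = ExprSubs l₂

    -- Relating the sequences and all their liftings by an inductive family
    -- avoids comparing σ ↑⋆ a ↑⋆ k with σ ↑⋆ (k + a), which have different types.
    data Lifting {m n} (σs : Subs S₁ m n) (τs : Subs S₂ m n) :
                 ∀ {m′ n′} → Subs S₁ m′ n′ → Subs S₂ m′ n′ → Set where
      lifting : ∀ k → Lifting σs τs (σs A.↑✶ k) (τs B.↑✶ k)

    module _ {m n} {σs : Subs S₁ m n} {τs : Subs S₂ m n}
             (eq : ∀ k x → var x A./✶ σs A.↑✶ k ≡ var x B./✶ τs B.↑✶ k) where

      lift-1 : ∀ {m′ n′} {ρs : Subs S₁ m′ n′} {θs : Subs S₂ m′ n′} →
               Lifting σs τs ρs θs → Lifting σs τs (ρs A.↑✶ 1) (θs B.↑✶ 1)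
      lift-1 (lifting k) =
        subst₂ (Lifting σs τs) (sym (A.↑✶-suc k σs)) (sym (B.↑✶-suc k τs)) (lifting (suc k))

      -- An alternative binds `a` variables at once; iterating `lift-1` keeps such a lifting inside
      -- the family.
      lift-by : ∀ a {m′ n′} {ρs : Subs S₁ m′ n′} {θs : Subs S₂ m′ n′} →
                Lifting σs τs ρs θs → Lifting σs τs (ρs A.↑✶ a) (θs B.↑✶ a)
      lift-by zero    {ρs = ρs} {θs} L =
        subst₂ (Lifting σs τs) (sym (A.↑✶-zero ρs)) (sym (B.↑✶-zero θs)) L
      lift-by (suc a) {ρs = ρs} {θs} L =
        subst₂ (Lifting σs τs) (A.↑✶-suc a ρs) (B.↑✶-suc a θs) (lift-1 (lift-by a L))

      -- Only the variable case uses `eq`; the others push both sequences through the constructor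
      -- and lift them under its binders.
      /✶-eq : ∀ {m′ n′} {ρs : Subs S₁ m′ n′} {θs : Subs S₂ m′ n′} →
              Lifting σs τs ρs θs → ∀ t → t A./✶ ρs ≡ t B./✶ θs
      /ᵛ✶-eq : ∀ {m′ n′} {ρs : Subs S₁ m′ n′} {θs : Subs S₂ m′ n′} →
               Lifting σs τs ρs θs → (ts : Vec (Expr m′) k) → ts A./ᵛ✶ ρs ≡ ts B./ᵛ✶ θs
      /ᵃ✶-eq : ∀ {m′ n′} {ρs : Subs S₁ m′ n′} {θs : Subs S₂ m′ n′} →
               Lifting σs τs ρs θs → (alts : Alts as m′) → alts A./ᵃ✶ ρs ≡ alts B./ᵃ✶ θs

      /✶-eq (lifting k) (var x) = eq k x
      /✶-eq {ρs = ρs} {θs} L (s · t) =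
        trans (A.·-/✶ ρs) (trans (cong₂ _·_ (/✶-eq L s) (/✶-eq L t)) (sym (B.·-/✶ θs)))
      /✶-eq {ρs = ρs} {θs} L (ƛ s) =
        trans (A.ƛ-/✶ ρs) (trans (cong ƛ (/✶-eq (lift-by 1 L) s)) (sym (B.ƛ-/✶ θs)))
      /✶-eq {ρs = ρs} {θs} L (con T c ss) =
        trans (A.con-/✶ ρs) (trans (cong (con T c) (/ᵛ✶-eq L ss)) (sym (B.con-/✶ θs)))
      /✶-eq {ρs = ρs} {θs} L (case T s alts) =
        trans (A.case-/✶ ρs)
          (trans (cong₂ (case T) (/✶-eq L s) (/ᵃ✶-eq L alts)) (sym (B.case-/✶ θs)))
      /✶-eq {ρs = ρs} {θs} L (seq s t) =
        trans (A.seq-/✶ ρs) (trans (cong₂ seq (/✶-eq L s) (/✶-eq L t)) (sym (B.seq-/✶ θs)))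

      /ᵛ✶-eq {ρs = ρs} {θs} L []       = trans (A.[]-/ᵛ✶ ρs) (sym (B.[]-/ᵛ✶ θs))
      /ᵛ✶-eq {ρs = ρs} {θs} L (t ∷ ts) =
        trans (A.∷-/ᵛ✶ ρs) (trans (cong₂ _∷_ (/✶-eq L t) (/ᵛ✶-eq L ts)) (sym (B.∷-/ᵛ✶ θs)))

      /ᵃ✶-eq {ρs = ρs} {θs} L []                  = trans (A.[]-/ᵃ✶ ρs) (sym (B.[]-/ᵃ✶ θs))
      /ᵃ✶-eq {ρs = ρs} {θs} L (_∷_ {x = a} r alts) =
        trans (A.∷-/ᵃ✶ ρs)
          (trans (cong₂ _∷_ (/✶-eq (lift-by a L) r) (/ᵃ✶-eq L alts)) (sym (B.∷-/ᵃ✶ θs)))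

  exprLemmas : TermLemmas Expr
  exprLemmas = record
    { termSubst = exprSubst
    ; app-var   = refl
    ; /✶-↑✶     = λ {_} {_} {l₁} {l₂} σs τs eq k →
                    SubsEq./✶-eq l₁ l₂ {σs = σs} {τs} eq (SubsEq.lifting k)
    }

  open TermLemmas exprLemmas
    using (id-vanishes; /-⊙; _⊙_; id-⊙; ⊙-id; weaken-∷; /Var≡/; weaken; _↑⋆_; lookup-id; map-var≡)
  open ExprApp (TermSubst.termLift exprSubst) using (_/ᵛ_; _/ᵃ_)

  -- All entries of `σ ↑⋆ suc k` but the first are weakened, so by `weaken-∷` the term substituted
  -- for the first variable drops out of them.
  ++-⊙ : (ss : Vec (Expr m) k) (σ : Sub Expr m n) →
         (ss ++ id) ⊙ σ ≡ (σ ↑⋆ k) ⊙ ((ss /ᵛ σ) ++ id)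
  ++-⊙ []       σ = trans id-⊙ (sym ⊙-id)
  ++-⊙ {k = suc k} (s ∷ ss) σ = cong (_ ∷_) (trans (++-⊙ ss σ) (trans
    (Vec.map-cong (λ t → sym (weaken-∷ t)) (σ ↑⋆ k))
    (Vec.map-∘ (_/ _) weaken (σ ↑⋆ k))))

  -- Contracting a redex commutes with instantiating it. This serves case reduction and also β,
  -- since `sub t` is `(t ∷ []) ++ id`.
  /-++-commutes : (r : Expr (k + m)) (ss : Vec (Expr m) k) (σ : Sub Expr m n) →
                  r / (ss ++ id) / σ ≡ r / (σ ↑⋆ k) / ((ss /ᵛ σ) ++ id)
  /-++-commutes r ss σ =
    trans (sym (/-⊙ r)) (trans (cong (r /_) (++-⊙ ss σ)) (/-⊙ r))

  alternative-/ : (alts : Alts as m) (c : Fin (length as)) (σ : Sub Expr m n) →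
    All.lookup (alts /ᵃ σ) (∈-lookup c) ≡ All.lookup alts (∈-lookup c) / (σ ↑⋆ lookup as c)
  alternative-/ (r ∷ alts) zero    σ = refl
  alternative-/ (r ∷ alts) (suc c) σ = alternative-/ alts c σ

  closed-/[] : (s : Closed) → s / [] ≡ s
  closed-/[] = id-vanishes

  -- Big-step evaluation

  infix 4 _⟱_

  -- Big-step form of `_↓_`: induction on a derivation gives direct access to the evaluations of
  -- subexpressions and reducts.
  data _⟱_ {n : ℕ} : Expr n → Expr n → Set where
    ƛ    : ∀ {s} → ƛ s ⟱ ƛ s
    con  : ∀ {T c ss} → con T c ss ⟱ con T c ss
    app  : ∀ {s s′ t v} → s ⟱ ƛ s′ → s′ / sub t ⟱ v → s · t ⟱ v
    case : ∀ {T s c ss v} {alts : Alts (arities T) n} → s ⟱ con T c ss →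
           alternative alts c / (ss ++ id) ⟱ v → case T s alts ⟱ v
    seq  : ∀ {s t v w} → s ⟱ v → t ⟱ w → seq s t ⟱ w

  Con⟱ : Expr n → Set
  Con⟱ t = ∃[ T ] ∃[ c ] ∃[ ts ] t ⟱ con T c ts

  ⟱-answer : {s v : Expr n} → s ⟱ v → Answer v
  ⟱-answer ƛ          = ƛ _
  ⟱-answer con        = con _ _ _
  ⟱-answer (app d e)  = ⟱-answer e
  ⟱-answer (case d e) = ⟱-answer e
  ⟱-answer (seq d e)  = ⟱-answer e

  answer-⟱ : {v : Expr n} → Answer v → v ⟱ v
  answer-⟱ (ƛ s)        = ƛ
  answer-⟱ (con T c ss) = con

  ⟱-deterministic : {s v w : Expr n} → s ⟱ v → s ⟱ w → v ≡ w
  ⟱-deterministic ƛ   ƛ   = refl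
  ⟱-deterministic con con = refl
  ⟱-deterministic (app d e) (app d′ e′) with refl ← ⟱-deterministic d d′ = ⟱-deterministic e e′
  ⟱-deterministic (case d e) (case d′ e′) with refl ← ⟱-deterministic d d′ = ⟱-deterministic e e′
  ⟱-deterministic (seq d e) (seq d′ e′) = ⟱-deterministic e e′

  ⟱-expand : {s t v : Expr n} → s ⟶ t → t ⟱ v → s ⟱ v
  ⟱-expand (inR □ β)                e          = app ƛ e
  ⟱-expand (inR □ caseβ)            e          = case con e
  ⟱-expand (inR □ (seqβ a))         e          = seq (answer-⟱ a) e
  ⟱-expand (inR (app R _) p)        (app d e)  = app (⟱-expand (inR R p) d) e
  ⟱-expand (inR (case _ R _) p)     (case d e) = case (⟱-expand (inR R p) d) e
  ⟱-expand (inR (seq R _) p)        (seq d e)  = seq (⟱-expand (inR R p) d) e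

  ⟱-reduce : {s t v : Expr n} → s ⟶ t → s ⟱ v → t ⟱ v
  ⟱-reduce (inR □ β)            (app ƛ e)    = e
  ⟱-reduce (inR □ caseβ)        (case con e) = e
  ⟱-reduce (inR □ (seqβ a))     (seq d e)    = e
  ⟱-reduce (inR (app R _) p)    (app d e)    = app (⟱-reduce (inR R p) d) e
  ⟱-reduce (inR (case _ R _) p) (case d e)   = case (⟱-reduce (inR R p) d) e
  ⟱-reduce (inR (seq R _) p)    (seq d e)    = seq (⟱-reduce (inR R p) d) e

  ⟱-expand⋆ : {s t v : Expr n} → s ⟶* t → t ⟱ v → s ⟱ v
  ⟱-expand⋆ ε        e = e
  ⟱-expand⋆ (p ◅ ps) e = ⟱-expand p (⟱-expand⋆ ps e)

  ⟱-reduce⋆ : {s t v : Expr n} → s ⟶* t → s ⟱ v → t ⟱ v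
  ⟱-reduce⋆ ε        e = e
  ⟱-reduce⋆ (p ◅ ps) e = ⟱-reduce⋆ ps (⟱-reduce p e)

  ⟶-app : {s t : Expr n} (u : Expr n) → s ⟶ t → s · u ⟶ t · u
  ⟶-app u (inR R p) = inR (app R u) p

  ⟶-case : ∀ T {s t : Expr n} (alts : Alts (arities T) n) → s ⟶ t → case T s alts ⟶ case T t alts
  ⟶-case T alts (inR R p) = inR (case T R alts) p

  ⟶-seq : {s t : Expr n} (u : Expr n) → s ⟶ t → seq s u ⟶ seq t u
  ⟶-seq u (inR R p) = inR (seq R u) p

  ⟱⇒⟶* : {s v : Expr n} → s ⟱ v → s ⟶* v
  ⟱⇒⟶* ƛ   = ε
  ⟱⇒⟶* con = ε
  ⟱⇒⟶* (app {t = t} d e) = gmap (_· t) (⟶-app t) (⟱⇒⟶* d) ◅◅ inR □ β ◅ ⟱⇒⟶* e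
  ⟱⇒⟶* (case {T = T} {alts = alts} d e) =
    gmap (λ s → case T s alts) (⟶-case T alts) (⟱⇒⟶* d) ◅◅ inR □ caseβ ◅ ⟱⇒⟶* e
  ⟱⇒⟶* (seq {t = t} d e) =
    gmap (λ s → seq s t) (⟶-seq t) (⟱⇒⟶* d) ◅◅ inR □ (seqβ (⟱-answer d)) ◅ ⟱⇒⟶* e

  ⟱⇒↓ : {s v : Expr n} → s ⟱ v → s ↓ v
  ⟱⇒↓ d = ⟱⇒⟶* d , ⟱-answer d

  ↓⇒⟱ : {s v : Expr n} → s ↓ v → s ⟱ v
  ↓⇒⟱ (ps , a) = ⟱-expand⋆ ps (answer-⟱ a)

  -- Closes an evaluation inside an open context, so that similarity, which lives on closed
  -- expressions, can be applied to it.
  ⟱-/ : {s v : Expr m} → s ⟱ v → (σ : Sub Expr m n) → s / σ ⟱ v / σ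
  ⟱-/ ƛ   σ = ƛ
  ⟱-/ con σ = con
  ⟱-/ (app {s′ = s′} {t} d e) σ =
    app (⟱-/ d σ) (subst (_⟱ _) (/-++-commutes s′ (t ∷ []) σ) (⟱-/ e σ))
  ⟱-/ (case {c = c} {ss} {alts = alts} d e) σ = case (⟱-/ d σ) (subst (_⟱ _)
    (trans (/-++-commutes (alternative alts c) ss σ)
           (cong (_/ _) (sym (alternative-/ alts c σ))))
    (⟱-/ e σ))
  ⟱-/ (seq d e) σ = seq (⟱-/ d σ) (⟱-/ e σ)

  -- Divergence and closing by Ω

  Ω : Expr n
  Ω = ƛ (var zero · var zero) · ƛ (var zero · var zero)

  -- The β-reduct of `Ω` is `Ω` itself, so a derivation would contain a smaller one of the same
  -- kind.
  Ω-diverges : {v : Expr n} → ¬ Ω ⟱ v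
  Ω-diverges (app ƛ e) = Ω-diverges e

  Ωs : Sub Expr n 0
  Ωs = Vec.replicate _ Ω

  -- A free variable in evaluation position would be turned into Ω, so
  -- instantiating all variables by Ω creates no new evaluations.
  ⟱-/Ωs : {u v : Closed} → u ⟱ v → (t : Expr n) → t / Ωs ≡ u →
          ∃[ v′ ] t ⟱ v′ × v′ / Ωs ≡ v
  ⟱-/Ωs d (var x) eq =
    ⊥-elim (Ω-diverges (subst (_⟱ _) (trans (sym eq) (Vec.lookup-replicate x Ω)) d))
  ⟱-/Ωs ƛ (ƛ s) eq = ƛ s , ƛ , eq
  ⟱-/Ωs con (con T c ss) eq = con T c ss , con , eq
  ⟱-/Ωs (app d e) (s · t) refl with ⟱-/Ωs d s refl
  ... | v , d′ , eq with ⟱-answer d′ | eq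
  ...   | ƛ s′ | refl with ⟱-/Ωs e (s′ / sub t) (/-++-commutes s′ (t ∷ []) Ωs)
  ...     | w , e′ , eq′ = w , app d′ e′ , eq′
  ⟱-/Ωs (case d e) (case T s alts) refl with ⟱-/Ωs d s refl
  ... | v , d′ , eq with ⟱-answer d′ | eq
  ...   | con _ c ss | refl
      with ⟱-/Ωs e (alternative alts c / (ss ++ id))
             (trans (/-++-commutes (alternative alts c) ss Ωs)
                    (cong (_/ _) (sym (alternative-/ alts c Ωs))))
  ...     | w , e′ , eq′ = w , case d′ e′ , eq′
  ⟱-/Ωs (seq d e) (seq s t) refl with ⟱-/Ωs d s refl | ⟱-/Ωs e t refl
  ... | _ , d′ , _ | w , e′ , eq = w , seq d′ e′ , eq

  -- Similarity is a preorder

  ⟱⊆⇒≼ : {s t : Closed} → (∀ {v} → s ⟱ v → t ⟱ v) → s ≼ t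
  ⟱⊆⇒≼ {s} {t} = ≼-greatest (λ u v → ∀ {w} → u ⟱ w → v ⟱ w) post s t
    where
    post : ∀ u v → (∀ {w} → u ⟱ w → v ⟱ w) → F (λ u v → ∀ {w} → u ⟱ w → v ⟱ w) u v
    -- Both sides reach the same answer, so its parts are related by the identity inclusion.
    post u v i =
      (λ e → inj₁ (_ , ⟱⇒↓ (i (↓⇒⟱ e)) , λ σ d → d)) ,
      (λ e → _ , ⟱⇒↓ (i (↓⇒⟱ e)) , λ j d → d)

  ≼-refl : {s : Closed} → s ≼ s
  ≼-refl = ⟱⊆⇒≼ (λ d → d)

  -- Used in `≼-trans` to pull `cBot` back: if the middle body never converges, neither does the
  -- left one it simulates.
  F-⇓ : {η : Rel Closed 0ℓ} {s t : Closed} → F η s t → s ⇓ → t ⇓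
  F-⇓ (f , g) (_ , e@(_ , ƛ _)) with f e
  ... | inj₁ (_ , d , _)           = _ , d
  ... | inj₂ ((_ , _ , _ , d) , _) = _ , d
  F-⇓ (f , g) (_ , e@(_ , con _ _ _)) with g e
  ... | _ , d , _ = _ , d

  -- Composing the two witnessing post-fixed points, rather than `_≼_` with itself, stays in the
  -- universe that `≼-greatest` accepts.
  ≼-trans : {s t u : Closed} → s ≼ t → t ≼ u → s ≼ u
  ≼-trans {s} {t} {u} (η , η-post , p) (θ , θ-post , q) =
    ≼-greatest η⨾θ post s u (t , p , q)
    where
    η⨾θ : Rel Closed 0ℓ
    η⨾θ a c = ∃[ b ] η a b × θ b c

    post : ∀ a c → η⨾θ a c → F η⨾θ a c
    post a c (b , x , y) = onƛ , onCon
      where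
      onƛ : ∀ {a′} → a ↓ ƛ a′ →
            (∃[ c′ ] c ↓ ƛ c′ × (η⨾θ ᵒ) a′ c′)
            ⊎ ((∃[ T ] ∃[ k ] ∃[ cs ] c ↓ con T k cs) × cBot a′)
      onƛ e with proj₁ (η-post a b x) e
      ... | inj₂ ((T , k , bs , d) , a′⊥) =
        let cs , d′ , _ = proj₂ (θ-post b c y) d in inj₂ ((T , k , cs , d′) , a′⊥)
      ... | inj₁ (b′ , d , h) with proj₁ (θ-post b c y) d
      ...   | inj₁ (c′ , d′ , h′) = inj₁ (c′ , d′ , λ σ → b′ / σ , h σ , h′ σ)
      ...   | inj₂ (d′ , b′⊥)     = inj₂ (d′ , λ σ e′ → b′⊥ σ (F-⇓ {η = η} (η-post _ _ (h σ)) e′))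

      onCon : ∀ {T k as} → a ↓ con T k as →
              ∃[ cs ] c ↓ con T k cs × (∀ i → η⨾θ (Vec.lookup as i) (Vec.lookup cs i))
      onCon e with proj₂ (η-post a b x) e
      ... | bs , d , h with proj₂ (θ-post b c y) d
      ...   | cs , d′ , h′ = cs , d′ , λ i → Vec.lookup bs i , h i , h′ i

  -- The Howe relation and its substitutivity

  infix 4 _≲_ _≾_ _≾ᵃ_

  -- A record, so that unification can recover `s` and `t`; the bare function type mentions only
  -- their instances `s / σ` and `t / σ`.
  record _≲_ (s t : Expr n) : Set₁ where
    constructor open-ext
    field at : (_≼_ ᵒ) s t
  open _≲_

  ⟱⊆⇒≲ : {s t : Expr n} → (∀ (σ : Sub Expr n 0) {v} → s / σ ⟱ v → t / σ ⟱ v) → s ≲ t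
  ⟱⊆⇒≲ i = open-ext λ σ → ⟱⊆⇒≼ (i σ)

  ≲-refl : {s : Expr n} → s ≲ s
  ≲-refl = open-ext λ σ → ≼-refl

  ≲-trans : {s t u : Expr n} → s ≲ t → t ≲ u → s ≲ u
  ≲-trans p q = open-ext λ σ → ≼-trans (at p σ) (at q σ)

  ≲-/ : {s t : Expr m} → s ≲ t → (σ : Sub Expr m n) → s / σ ≲ t / σ
  ≲-/ {s = s} {t} p σ = open-ext λ τ → subst₂ _≼_ (/-⊙ s) (/-⊙ t) (at p (σ ⊙ τ))

  ≲-/Var : {s t : Expr m} → s ≲ t → (ρ : Sub Fin m n) → s /Var ρ ≲ t /Var ρ
  ≲-/Var {s = s} {t} p ρ =
    subst₂ _≲_ (sym (/Var≡/ {t = s})) (sym (/Var≡/ {t = t})) (≲-/ p (map var ρ))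

  ≲⇒≼ : {s t : Closed} → s ≲ t → s ≼ t
  ≲⇒≼ p = subst₂ _≼_ (closed-/[] _) (closed-/[] _) (at p [])

  ≼⇒≲ : {s t : Closed} → s ≼ t → s ≲ t
  ≼⇒≲ p = open-ext λ { [] → subst₂ _≼_ (sym (closed-/[] _)) (sym (closed-/[] _)) p }

  cBot⇒≲Ω : {s : Expr n} → cBot s → s ≲ Ω
  cBot⇒≲Ω s⊥ = ⟱⊆⇒≲ λ σ d → ⊥-elim (s⊥ σ (_ , ⟱⇒↓ d))

  -- The Howe closure of `≲`. Each rule ends in one `≲` step, which yields `≾-≲-trans` without
  -- transitivity of `≾`.
  data _≾_ {n} : Expr n → Expr n → Set₁
  data _≾ᵃ_ {n} : ∀ {as} → Alts as n → Alts as n → Set₁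

  data _≾_ {n} where
    var  : ∀ {x u} → var x ≲ u → var x ≾ u
    app  : ∀ {s s′ t t′ u} → s ≾ s′ → t ≾ t′ → s′ · t′ ≲ u → s · t ≾ u
    ƛ    : ∀ {s s′ u} → s ≾ s′ → ƛ s′ ≲ u → ƛ s ≾ u
    con  : ∀ {T c ss ss′ u} → Pointwise _≾_ ss ss′ → con T c ss′ ≲ u → con T c ss ≾ u
    case : ∀ {T s s′ u} {alts alts′ : Alts (arities T) n} → s ≾ s′ → alts ≾ᵃ alts′ →
           case T s′ alts′ ≲ u → case T s alts ≾ u
    seq  : ∀ {s s′ t t′ u} → s ≾ s′ → t ≾ t′ → seq s′ t′ ≲ u → seq s t ≾ u

  data _≾ᵃ_ {n} where
    []  : [] ≾ᵃ []
    _∷_ : ∀ {a as} {r r′ : Expr (a + n)} {alts alts′ : Alts as n} →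
          r ≾ r′ → alts ≾ᵃ alts′ → (r ∷ alts) ≾ᵃ (r′ ∷ alts′)

  ≾-≲-trans : {s t u : Expr n} → s ≾ t → t ≲ u → s ≾ u
  ≾-≲-trans (var p)      q = var (≲-trans p q)
  ≾-≲-trans (app h i p)  q = app h i (≲-trans p q)
  ≾-≲-trans (ƛ h p)      q = ƛ h (≲-trans p q)
  ≾-≲-trans (con h p)    q = con h (≲-trans p q)
  ≾-≲-trans (case h i p) q = case h i (≲-trans p q)
  ≾-≲-trans (seq h i p)  q = seq h i (≲-trans p q)

  ≾-refl  : (s : Expr n) → s ≾ s
  ≾ᵛ-refl : (ss : Vec (Expr n) k) → Pointwise _≾_ ss ss
  ≾ᵃ-refl : (alts : Alts as n) → alts ≾ᵃ alts

  ≾-refl (var x)         = var ≲-refl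
  ≾-refl (s · t)         = app (≾-refl s) (≾-refl t) ≲-refl
  ≾-refl (ƛ s)           = ƛ (≾-refl s) ≲-refl
  ≾-refl (con T c ss)    = con (≾ᵛ-refl ss) ≲-refl
  ≾-refl (case T s alts) = case (≾-refl s) (≾ᵃ-refl alts) ≲-refl
  ≾-refl (seq s t)       = seq (≾-refl s) (≾-refl t) ≲-refl

  ≾ᵛ-refl []       = []
  ≾ᵛ-refl (s ∷ ss) = ≾-refl s ∷ ≾ᵛ-refl ss

  ≾ᵃ-refl []         = []
  ≾ᵃ-refl (r ∷ alts) = ≾-refl r ∷ ≾ᵃ-refl alts

  ≲⇒≾ : {s t : Expr n} → s ≲ t → s ≾ t
  ≲⇒≾ = ≾-≲-trans (≾-refl _)

  ≾ᵃ-lookup : {alts alts′ : Alts as n} → alts ≾ᵃ alts′ → (c : Fin (length as)) →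
              All.lookup alts (∈-lookup c) ≾ All.lookup alts′ (∈-lookup c)
  ≾ᵃ-lookup (h ∷ hs) zero    = h
  ≾ᵃ-lookup (h ∷ hs) (suc c) = ≾ᵃ-lookup hs c

  -- Instantiated first with renamings, then with expression substitutions: lifting the latter under
  -- a binder weakens their entries, so stability of `≾` under renaming has to come first.
  module ≾-Application
    (l : Lift S Expr) {ℓ : Level} (_~_ : ∀ {n} → S n → S n → Set ℓ)
    (~-var    : ∀ {n} {x : Fin n} → Lift.var l x ~ Lift.var l x)
    (~-weaken : ∀ {n} {a b : S n} → a ~ b → Lift.weaken l a ~ Lift.weaken l b)
    (~-lift   : ∀ {n} {a b : S n} → a ~ b → Lift.lift l a ≾ Lift.lift l b)
    (≲-app    : ∀ {m n} {s t : Expr m} → s ≲ t → (σ : Sub S m n) →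
                ExprApp._/_ l s σ ≲ ExprApp._/_ l t σ) where

    private module L = Lift l
    open ExprApp l using () renaming (_/_ to _/₁_; _/ᵛ_ to _/ᵛ₁_; _/ᵃ_ to _/ᵃ₁_)

    ~-↑⋆ : ∀ k {σ τ : Sub S m n} → Pointwise _~_ σ τ → Pointwise _~_ (σ L.↑⋆ k) (τ L.↑⋆ k)
    ~-↑⋆ zero    p = p
    ~-↑⋆ (suc k) p = ~-var ∷ Pointwise.map⁺ ~-weaken (~-↑⋆ k p)

    ≾-app  : {s t : Expr m} {σ τ : Sub S m n} → s ≾ t → Pointwise _~_ σ τ →
             s /₁ σ ≾ t /₁ τ
    ≾ᵛ-app : {ss ts : Vec (Expr m) k} {σ τ : Sub S m n} → Pointwise _≾_ ss ts →
             Pointwise _~_ σ τ → Pointwise _≾_ (ss /ᵛ₁ σ) (ts /ᵛ₁ τ)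
    ≾ᵃ-app : {alts alts′ : Alts as m} {σ τ : Sub S m n} → alts ≾ᵃ alts′ →
             Pointwise _~_ σ τ → (alts /ᵃ₁ σ) ≾ᵃ (alts′ /ᵃ₁ τ)

    -- The path goes through `var x` under `τ`: first the related entries at `x`, then `var x ≲ u`
    -- instantiated by `τ`.
    ≾-app (var {x} p)  e = ≾-≲-trans (~-lift (Pointwise.lookup e x)) (≲-app p _)
    ≾-app (app h i p)  e = app (≾-app h e) (≾-app i e) (≲-app p _)
    ≾-app (ƛ h p)      e = ƛ (≾-app h (~-↑⋆ 1 e)) (≲-app p _)
    ≾-app (con h p)    e = con (≾ᵛ-app h e) (≲-app p _)
    ≾-app (case h i p) e = case (≾-app h e) (≾ᵃ-app i e) (≲-app p _)
    ≾-app (seq h i p)  e = seq (≾-app h e) (≾-app i e) (≲-app p _)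

    ≾ᵛ-app []       e = []
    ≾ᵛ-app (h ∷ hs) e = ≾-app h e ∷ ≾ᵛ-app hs e

    ≾ᵃ-app []                 e = []
    ≾ᵃ-app (_∷_ {a = a} h hs) e = ≾-app h (~-↑⋆ a e) ∷ ≾ᵃ-app hs e

  ≾-/Var : {s t : Expr m} → s ≾ t → (ρ : Sub Fin m n) → s /Var ρ ≾ t /Var ρ
  ≾-/Var h ρ = ≾-Application.≾-app (TermSubst.varLift exprSubst) _≡_ refl (cong suc)
    (λ { refl → ≾-refl _ }) ≲-/Var h (Pointwise.refl refl)

  ≾-/ : {s t : Expr m} {σ τ : Sub Expr m n} → s ≾ t → Pointwise _≾_ σ τ → s / σ ≾ t / τ
  ≾-/ = ≾-Application.≾-app (TermSubst.termLift exprSubst) _≾_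
          (≾-refl _) (λ h → ≾-/Var h _) (λ h → h) ≲-/

  ≾-/-++ : {r r′ : Expr (k + n)} {ss ts : Vec (Expr n) k} → r ≾ r′ → Pointwise _≾_ ss ts →
           r / (ss ++ id) ≾ r′ / (ts ++ id)
  ≾-/-++ h hs = ≾-/ h (Pointwise.++⁺ hs (≾ᵛ-refl id))

  -- The Howe relation preserves convergence

  -- ƛcon says s ≾ Ω rather than cBot s: that cBot is closed downwards under ≾
  -- is only known once ≾ has been shown to preserve convergence.
  data Matches : Closed → Closed → Set₁ where
    ƛ    : ∀ {s t t′} → t ⟱ ƛ t′ → s ≾ t′ → Matches (ƛ s) t
    ƛcon : ∀ {s t} → Con⟱ t → s ≾ Ω → Matches (ƛ s) t
    con  : ∀ {T c ss ts t} → t ⟱ con T c ts → Pointwise _≾_ ss ts → Matches (con T c ss) t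

  Matches-⟱ : ∀ {v t} → Matches v t → ∃[ w ] t ⟱ w
  Matches-⟱ (ƛ d _)                  = _ , d
  Matches-⟱ (ƛcon (_ , _ , _ , d) _) = _ , d
  Matches-⟱ (con d _)                = _ , d

  Matches-expand : ∀ {v t u} → (∀ {w} → t ⟱ w → u ⟱ w) → Matches v t → Matches v u
  Matches-expand i (ƛ d h)                  = ƛ (i d) h
  Matches-expand i (ƛcon (_ , _ , _ , d) h) = ƛcon (_ , _ , _ , i d) h
  Matches-expand i (con d h)                = con (i d) h

  Pointwise-≾-≲ : {ss ts us : Vec (Expr n) k} → Pointwise _≾_ ss ts →
                  (∀ i → Vec.lookup ts i ≲ Vec.lookup us i) → Pointwise _≾_ ss us
  Pointwise-≾-≲ {us = []}     []       p = []
  Pointwise-≾-≲ {us = _ ∷ _} (h ∷ hs) p = ≾-≲-trans h (p zero) ∷ Pointwise-≾-≲ hs (p ∘ suc)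

  -- Absorbs the trailing similarity of a Howe rule: the clause of `F` for the answer of `t` carries
  -- the match on to `u`.
  Matches-≼ : ∀ {v t u} → Matches v t → t ≼ u → Matches v u
  Matches-≼ (ƛ d h) p with proj₁ (≼⇒F _ _ p) (⟱⇒↓ d)
  ... | inj₁ (_ , e , q)              = ƛ (↓⇒⟱ e) (≾-≲-trans h (open-ext q))
  ... | inj₂ ((_ , _ , _ , e) , t′⊥)  =
    ƛcon (_ , _ , _ , ↓⇒⟱ e) (≾-≲-trans h (cBot⇒≲Ω t′⊥))
  Matches-≼ (ƛcon (_ , _ , _ , d) h) p with proj₂ (≼⇒F _ _ p) (⟱⇒↓ d)
  ... | _ , e , _ = ƛcon (_ , _ , _ , ↓⇒⟱ e) h
  Matches-≼ (con d h) p with proj₂ (≼⇒F _ _ p) (⟱⇒↓ d)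
  ... | _ , e , q = con (↓⇒⟱ e) (Pointwise-≾-≲ h (λ i → ≼⇒≲ (q i)))

  -- Substitutivity of `≾` relates the two reducts, so the induction hypothesis applies to the
  -- premise that evaluates the left reduct.
  ≾-⟱ : {s t v : Closed} → s ⟱ v → s ≾ t → Matches v t
  ≾-⟱ ƛ   (ƛ h p)   = Matches-≼ (ƛ ƛ h) (≲⇒≼ p)
  ≾-⟱ con (con h p) = Matches-≼ (con con h) (≲⇒≼ p)
  ≾-⟱ (app d e) (app h i p) with ≾-⟱ d h
  ... | ƛ d′ j = Matches-≼ (Matches-expand (app d′) (≾-⟱ e (≾-/-++ j (i ∷ [])))) (≲⇒≼ p)
  ... | ƛcon _ j =
    ⊥-elim (Ω-diverges (proj₂ (Matches-⟱ (≾-⟱ e (≾-/-++ j (i ∷ []))))))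
  ≾-⟱ (case {c = c} d e) (case h i p) with ≾-⟱ d h
  ... | con d′ j =
    Matches-≼ (Matches-expand (case d′) (≾-⟱ e (≾-/-++ (≾ᵃ-lookup i c) j))) (≲⇒≼ p)
  -- `seq` needs just some answer of its first argument, so every form of match is good enough here.
  ≾-⟱ (seq d e) (seq h i p) with Matches-⟱ (≾-⟱ d h)
  ... | _ , d′ = Matches-≼ (Matches-expand (seq d′) (≾-⟱ e i)) (≲⇒≼ p)

  -- Similarity implies contextual preorder

  ≾-[]  : {s t : Expr n} → s ≲ t → (C : Ctx n m) → C [ s ] ≾ C [ t ]
  ≾-[]ᵛ : {s t : Expr n} → s ≲ t → (Cs : VecCtx n m k) → Pointwise _≾_ (Cs [ s ]ᵛ) (Cs [ t ]ᵛ)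
  ≾-[]ᵃ : {s t : Expr n} → s ≲ t → (Cs : AltsCtx n m as) → (Cs [ s ]ᵃ) ≾ᵃ (Cs [ t ]ᵃ)

  ≾-[] p (hole ρ)       = ≲⇒≾ (≲-/Var p _)
  ≾-[] p (appˡ C t)     = app (≾-[] p C) (≾-refl t) ≲-refl
  ≾-[] p (appʳ t C)     = app (≾-refl t) (≾-[] p C) ≲-refl
  ≾-[] p (ƛ C)          = ƛ (≾-[] p C) ≲-refl
  ≾-[] p (con T c Cs)   = con (≾-[]ᵛ p Cs) ≲-refl
  ≾-[] p (caseˢ T C as) = case (≾-[] p C) (≾ᵃ-refl as) ≲-refl
  ≾-[] p (caseᵃ T t Cs) = case (≾-refl t) (≾-[]ᵃ p Cs) ≲-refl
  ≾-[] p (seqˡ C t)     = seq (≾-[] p C) (≾-refl t) ≲-refl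
  ≾-[] p (seqʳ t C)     = seq (≾-refl t) (≾-[] p C) ≲-refl

  ≾-[]ᵛ p (here C ts)  = ≾-[] p C ∷ ≾ᵛ-refl ts
  ≾-[]ᵛ p (there t Cs) = ≾-refl t ∷ ≾-[]ᵛ p Cs

  ≾-[]ᵃ p (here C as)  = ≾-[] p C ∷ ≾ᵃ-refl as
  ≾-[]ᵃ p (there r Cs) = ≾-refl r ∷ ≾-[]ᵃ p Cs

  -- `C [ s ]` may be open while `≾-⟱` needs closed expressions: both sides are instantiated by
  -- `Ωs`, and `⟱-/Ωs` removes the instantiation from the resulting evaluation.
  ≲⇒≤lcc : {s t : Expr n} → s ≲ t → s ≤lcc t
  ≲⇒≤lcc {t = t} p C (_ , d)
    with _ , e ← Matches-⟱ (≾-⟱ (⟱-/ (↓⇒⟱ d) Ωs) (≾-/ (≾-[] p C) (≾ᵛ-refl Ωs)))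
    with _ , e′ , _ ← ⟱-/Ωs e (C [ t ]) refl
    = _ , ⟱⇒↓ e′

  -- Composition of contexts and compatibility of the contextual preorder

  graft  : (∀ {k} → Fin n ↣ Fin k → Ctx o k) → Ctx n m → Ctx o m
  graftᵛ : (∀ {k} → Fin n ↣ Fin k → Ctx o k) → VecCtx n m k → VecCtx o m k
  graftᵃ : (∀ {k} → Fin n ↣ Fin k → Ctx o k) → AltsCtx n m as → AltsCtx o m as

  -- The hole renames along `ρ`, so `f` supplies the inner context already renamed along `ρ`.
  graft f (hole ρ)       = f ρ
  graft f (appˡ C t)     = appˡ (graft f C) t
  graft f (appʳ t C)     = appʳ t (graft f C)
  graft f (ƛ C)          = ƛ (graft f C)
  graft f (con T c Cs)   = con T c (graftᵛ f Cs)
  graft f (caseˢ T C as) = caseˢ T (graft f C) as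
  graft f (caseᵃ T t Cs) = caseᵃ T t (graftᵃ f Cs)
  graft f (seqˡ C t)     = seqˡ (graft f C) t
  graft f (seqʳ t C)     = seqʳ t (graft f C)

  graftᵛ f (here C ts)  = here (graft f C) ts
  graftᵛ f (there t Cs) = there t (graftᵛ f Cs)

  graftᵃ f (here C as)  = here (graft f C) as
  graftᵃ f (there r Cs) = there r (graftᵃ f Cs)

  module _ {n o} (f : ∀ {k} → Fin n ↣ Fin k → Ctx o k) (P : Expr o → Expr n)
           (f-[] : ∀ s {k} (ρ : Fin n ↣ Fin k) → f ρ [ s ] ≡ P s /Var tabulate (Injection.to ρ)) where

    graft-[]  : ∀ s (C : Ctx n m) → graft f C [ s ] ≡ C [ P s ]
    graftᵛ-[] : ∀ s (Cs : VecCtx n m k) → graftᵛ f Cs [ s ]ᵛ ≡ Cs [ P s ]ᵛ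
    graftᵃ-[] : ∀ s (Cs : AltsCtx n m as) → graftᵃ f Cs [ s ]ᵃ ≡ Cs [ P s ]ᵃ

    graft-[] s (hole ρ)       = f-[] s ρ
    graft-[] s (appˡ C t)     = cong (_· t) (graft-[] s C)
    graft-[] s (appʳ t C)     = cong (t ·_) (graft-[] s C)
    graft-[] s (ƛ C)          = cong ƛ (graft-[] s C)
    graft-[] s (con T c Cs)   = cong (con T c) (graftᵛ-[] s Cs)
    graft-[] s (caseˢ T C as) = cong (λ u → case T u as) (graft-[] s C)
    graft-[] s (caseᵃ T t Cs) = cong (case T t) (graftᵃ-[] s Cs)
    graft-[] s (seqˡ C t)     = cong (λ u → seq u t) (graft-[] s C)
    graft-[] s (seqʳ t C)     = cong (seq t) (graft-[] s C)

    graftᵛ-[] s (here C ts)  = cong (_∷ ts) (graft-[] s C)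
    graftᵛ-[] s (there t Cs) = cong (t ∷_) (graftᵛ-[] s Cs)

    graftᵃ-[] s (here C as)  = cong (_∷ as) (graft-[] s C)
    graftᵃ-[] s (there r Cs) = cong (r ∷_) (graftᵃ-[] s Cs)

    -- A context `C` observing `P s` is the context `graft f C` observing `s`.
    ≤lcc-frame : ∀ {s t} → s ≤lcc t → P s ≤lcc P t
    ≤lcc-frame {s} {t} p C d =
      subst _⇓ (graft-[] t C) (p (graft f C) (subst _⇓ (sym (graft-[] s C)) d))

  ↣-lift : Fin m ↣ Fin n → Fin (suc m) ↣ Fin (suc n)
  ↣-lift ρ = mk↣ (lift-injective (Injection.to ρ) (Injection.injective ρ) 1)

  ≤lcc-ƛ : {s t : Expr (suc n)} → s ≤lcc t → ƛ s ≤lcc ƛ t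
  ≤lcc-ƛ {s = s} {t} = ≤lcc-frame (λ ρ → ƛ (hole (↣-lift ρ))) ƛ
    (λ s ρ → cong (λ σ → ƛ (s /Var (zero ∷ σ))) (Vec.tabulate-∘ suc (Injection.to ρ))) {s} {t}

  ≤lcc-app : {s t : Expr n} (u : Expr n) → s ≤lcc t → s · u ≤lcc t · u
  ≤lcc-app {s = s} {t} u =
    ≤lcc-frame (λ ρ → appˡ (hole ρ) (u /Var tabulate (Injection.to ρ))) (_· u)
      (λ s ρ → refl) {s} {t}

  ≤lcc-case : ∀ {T} {s t : Expr n} (alts : Alts (arities T) n) → s ≤lcc t →
              case T s alts ≤lcc case T t alts
  ≤lcc-case {T = T} {s} {t} alts =
    ≤lcc-frame
      (λ ρ → caseˢ T (hole ρ) (alts /ᵃVar tabulate (Injection.to ρ)))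
      (λ s → case T s alts) (λ s ρ → refl) {s} {t}
    where open ExprApp (TermSubst.varLift exprSubst) using () renaming (_/ᵃ_ to _/ᵃVar_)

  -- The contextual preorder is a simulation

  /Var-id : (s : Expr n) → s /Var tabulate (λ x → x) ≡ s
  /Var-id s = trans (/Var≡/ {t = s}) (trans
    (cong (s /_) (map-var≡ (Vec.lookup∘tabulate (λ x → x)) lookup-id))
    (id-vanishes s))

  ≤lcc-⟱ : {s t v : Expr n} → s ≤lcc t → s ⟱ v → ∃[ w ] t ⟱ w
  ≤lcc-⟱ {s = s} {t} p d
    with w , e ← p (hole (↣-id _)) (subst _⇓ (sym (/Var-id s)) (_ , ⟱⇒↓ d))
    = w , ↓⇒⟱ (subst (_↓ w) (/Var-id t) e)

  -- By the direction already proved, either end of a contextual inequality may be exchanged along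
  -- similarity, in particular for an expression with the same evaluations.
  ≲-≤lcc-≲-trans : {s s′ t t′ : Expr n} → s ≲ s′ → s′ ≤lcc t′ → t′ ≲ t → s ≤lcc t
  ≲-≤lcc-≲-trans p q r C d = ≲⇒≤lcc r C (q C (≲⇒≤lcc p C d))

  -- With an answer as `r`, a `case` with these alternatives tests for the constructor `c`; with a
  -- pattern variable as `r`, it projects to a component.
  select : ∀ as (c : Fin (length as)) → Expr (lookup as c + n) → Alts as n
  select (_ ∷ _)  zero    r = r ∷ All.tabulate (λ _ → Ω)
  select (_ ∷ as) (suc c) r = Ω ∷ select as c r

  select-≡ : ∀ as (c : Fin (length as)) (r : Expr (lookup as c + n)) →
             All.lookup (select {n} as c r) (∈-lookup c) ≡ r
  select-≡ (_ ∷ _)  zero    r = refl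
  select-≡ (_ ∷ as) (suc c) r = select-≡ as c r

  tabulate-Ω : ∀ as (c : Fin (length as)) →
               All.lookup {P = λ a → Expr (a + n)} (All.tabulate {xs = as} (λ _ → Ω)) (∈-lookup c) ≡ Ω
  tabulate-Ω (_ ∷ _)  zero    = refl
  tabulate-Ω (_ ∷ as) (suc c) = tabulate-Ω as c

  select-≢ : ∀ as (c c′ : Fin (length as)) (r : Expr (lookup as c + n)) → c ≢ c′ →
             All.lookup (select {n} as c r) (∈-lookup c′) ≡ Ω
  select-≢ (_ ∷ _)  zero    zero     r c≢c′ = ⊥-elim (c≢c′ refl)
  select-≢ (_ ∷ as) zero    (suc c′) r c≢c′ = tabulate-Ω as c′
  select-≢ (_ ∷ _)  (suc c) zero     r c≢c′ = refl
  select-≢ (_ ∷ as) (suc c) (suc c′) r c≢c′ = select-≢ as c c′ r (c≢c′ ∘ cong suc)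

  select-var : ∀ {T c} (ss : Vec (Expr n) (ar T c)) (i : Fin (ar T c)) →
               alternative {T = T} (select (arities T) c (var (i ↑ˡ n))) c / (ss ++ id) ≡
               Vec.lookup ss i
  select-var {n} {T} {c} ss i =
    trans (cong (_/ (ss ++ id)) (select-≡ (arities T) c (var (i ↑ˡ n)))) (Vec.lookup-++ˡ ss id i)

  app-⟱⁻¹ : {s t v : Expr n} {s′ : Expr (suc n)} → s ⟱ ƛ s′ → s · t ⟱ v → s′ / sub t ⟱ v
  app-⟱⁻¹ d (app d′ e) with refl ← ⟱-deterministic d d′ = e

  ≤lcc-post : (s t : Closed) → s ≤lcc t → F _≤lcc_ s t
  ≤lcc-post s t p = onƛ , onCon
    where
    -- Closed, so it survives the substitution for the pattern variables unchanged.
    answer : Expr n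
    answer = ƛ (var zero)

    onƛ : ∀ {s′} → s ↓ ƛ s′ →
          (∃[ t′ ] t ↓ ƛ t′ × (_≤lcc_ ᵒ) s′ t′)
          ⊎ ((∃[ T ] ∃[ c ] ∃[ ts ] t ↓ con T c ts) × cBot s′)
    onƛ e with ≤lcc-⟱ {s = s} {t} p (↓⇒⟱ e)
    ... | _ , d with ⟱-answer d
    -- Since `s` evaluates to `ƛ s′`, the application `s · r` evaluates like the instance of `s′` at
    -- `r`, and likewise for `t`; the application context thus compares the bodies.
    ...   | ƛ t′ = inj₁ (t′ , ⟱⇒↓ d , λ { (r ∷ []) → ≲-≤lcc-≲-trans
              (≼⇒≲ (⟱⊆⇒≼ (app (↓⇒⟱ e))))
              (≤lcc-app {s = s} {t} r p)
              (≼⇒≲ (⟱⊆⇒≼ (app-⟱⁻¹ d))) })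
    -- If the instance of `s′` at `r` converged, so would `s · r` and hence `t · r`, but `t`
    -- evaluates to a constructor application.
    ...   | con T c ts = inj₂ ((T , c , ts , ⟱⇒↓ d) , λ { (r ∷ []) (_ , e′) →
              no-app (≤lcc-⟱ {s = s · r} {t · r} (≤lcc-app {s = s} {t} r p)
                        (app (↓⇒⟱ e) (↓⇒⟱ e′))) d })
      where
      no-app : ∀ {r T c ts} → ∃[ w ] t · r ⟱ w → ¬ t ⟱ con T c ts
      no-app (_ , app d₁ _) d with () ← ⟱-deterministic d₁ d

    onCon : ∀ {T c ss} → s ↓ con T c ss →
            ∃[ ts ] t ↓ con T c ts × (∀ i → Vec.lookup ss i ≤lcc Vec.lookup ts i)
    onCon {T} {c} {ss} e
      with ≤lcc-⟱ {s = case T s (select (arities T) c answer)} {case T t _}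
             (≤lcc-case {s = s} {t} _ p)
             (case (↓⇒⟱ e)
               (subst (λ u → u / (ss ++ id) ⟱ answer) (sym (select-≡ (arities T) c answer)) ƛ))
    -- The `case` fixes the type `T`, so only the position of the constructor is left to compare; a
    -- different one would select `Ω`.
    ... | _ , case {c = c′} {ts} d d′ with c ≟ c′
    ...   | no c≢c′ = ⊥-elim (Ω-diverges
      (subst (λ u → u / (ts ++ id) ⟱ _) (select-≢ (arities T) c c′ _ c≢c′) d′))
    -- Selecting the `i`-th pattern variable makes the `case` evaluate like the `i`-th argument on
    -- both sides.
    ...   | yes refl = ts , ⟱⇒↓ d , λ i → ≲-≤lcc-≲-trans
      (≼⇒≲ (⟱⊆⇒≼ λ d₁ → case (↓⇒⟱ e) (subst (_⟱ _) (sym (select-var {T = T} ss i)) d₁)))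
      (≤lcc-case {s = s} {t} (select (arities T) c (var (i ↑ˡ 0))) p)
      (≼⇒≲ (⟱⊆⇒≼ (component i)))
      where
      component : ∀ i {w} → case T t (select (arities T) c (var (i ↑ˡ 0))) ⟱ w →
                  Vec.lookup ts i ⟱ w
      component i (case d₁ d₂) with refl ← ⟱-deterministic d₁ d =
        subst (_⟱ _) (select-var {T = T} ts i) d₂

  -- From closed to open expressions

  ≲-β : (s : Expr (suc n)) (u : Expr n) → s / sub u ≲ ƛ s · u
  ≲-β s u = ⟱⊆⇒≲ λ σ d → app ƛ (subst (_⟱ _) (/-++-commutes s (u ∷ []) σ) d)

  ≲-β⁻¹ : (s : Expr (suc n)) (u : Expr n) → ƛ s · u ≲ s / sub u
  ≲-β⁻¹ s u = ⟱⊆⇒≲ λ { σ (app ƛ d) → subst (_⟱ _) (sym (/-++-commutes s (u ∷ []) σ)) d }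

  -- `r / []` is the closed `r` viewed in a larger scope; applying `σ` to it gives back `r`.
  /-∷ : (s : Expr (suc n)) (r : Closed) (σ : Sub Expr n 0) →
        s / sub (r / []) / σ ≡ s / (r ∷ σ)
  /-∷ s r σ = trans (sym (/-⊙ s)) (cong (s /_) (cong₂ _∷_
    (trans (sym (/-⊙ r)) (closed-/[] r)) id-⊙))

  -- One variable at a time, s / (r ∷ σ) is the β-reduct of (ƛ s · r) / σ.
  ≤lcc-closing : (s t : Expr n) → s ≤lcc t → (σ : Sub Expr n 0) → (s / σ) ≤lcc (t / σ)
  ≤lcc-closing s t p [] = subst₂ _≤lcc_ (sym (closed-/[] s)) (sym (closed-/[] t)) p
  ≤lcc-closing s t p (r ∷ σ) = subst₂ _≤lcc_ (/-∷ s r σ) (/-∷ t r σ)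
    (≤lcc-closing (s / sub (r / [])) (t / sub (r / []))
      (≲-≤lcc-≲-trans (≲-β s _) (≤lcc-app {s = ƛ s} {ƛ t} _ (≤lcc-ƛ {s = s} {t} p)) (≲-β⁻¹ t _)) σ)

  ≤lcc⇒≲ : {s t : Expr n} → s ≤lcc t → s ≲ t
  ≤lcc⇒≲ {s = s} {t} p = open-ext λ σ →
    ≼-greatest _≤lcc_ ≤lcc-post (s / σ) (t / σ) (≤lcc-closing s t p σ)

theorem4p34 : (Sig : Signature) → let open Lcc Sig in
    ∀ {n : ℕ} (s t : Expr n) → (_≼_ ᵒ) s t ⇔ s ≤lcc t
theorem4p34 Sig {n} s t = mk⇔ sound complete
  where
  open Lcc Sig
  open Adequacy Sig

  sound : (_≼_ ᵒ) s t → s ≤lcc t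
  sound p = ≲⇒≤lcc (open-ext p)

  complete : s ≤lcc t → (_≼_ ᵒ) s t
  complete p = _≲_.at (≤lcc⇒≲ {s = s} {t} p)
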